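{- Let $H$ be a quasi-complete digraph on $S$ with complete part $T$, and let $(G,S,c)$ be an inner Eulerian network such that the Eulerian condition is fulfilled by each terminal $s$ incident to at most $|T|-2$ edges of $H$. Then $\mathrm{MFP}^*(\mu_H;G,S,c)=\mathrm{IMFP}^*(\mu_H;G,S,c)$, and this common value equals $\sum_{s\in T}\min\{c(\partial X): s\in X\subseteq VG\setminus N_H(s)\}$ if $H$ is sink-type, and $\sum_{s\in T}\min\{c(\partial X): N_H(s)\subseteq X\subseteq VG\setminus\{s\}\}$ if $H$ is source-type.
   Context: A network $(G,S,c)$: finite digraph $G=(VG,EG)$, terminals $S\subseteq VG$, capacity $c:EG\to\mathbb Z_+$. A multiflow is a set $\mathcal P$ of directed paths joining distinct terminals with $\lambda:\mathcal P\to\mathbb R_+$, $\sum_{P\ni e}\lambda(P)\le c(e)$; integral if $\lambda$ integer-valued. For a directed distance $\mu$ on $S$, $\mathrm{MFP}^*(\mu;G,S,c)$ (resp. $\mathrm{IMFP}^*$) is the maximum of $\sum_P\lambda(P)\mu(s_P,t_P)$ ($s_P,t_P$ start and end of $P$) over all (resp. integral) multiflows. A node fulfills the Eulerian condition if its outgoing capacity equals its incoming capacity; inner Eulerian means every non-terminal node does. $\partial X$ is the set of edges of $G$ leaving $X\subseteq VG$. For a simple digraph $H$ with $VH=S$, $\mu_H(s,t)=1$ if $st\in EH$ and $0$ otherwise; $N_H(s)$ is the set of nodes joined to $s$ by an edge of $H$ (in either direction). A quasi-complete digraph is a simple digraph $H$ with a node subset $T$ (complete part) such that (0) every edge is incident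 to $T$, (1) the subgraph induced by $T$ is a complete digraph, and (2) the edges between $T$ and $VH\setminus T$ either all leave $T$ or all enter $T$. $H$ is source-type if these edges enter $T$ and sink-type otherwise.
   Formalization: The weights λ(P) of the (non-integral) multiflows over which MFP* is maximized are nonnegative rationals instead of nonnegative reals. -}

module Defs where

open import Data.Nat as ℕ using (ℕ; zero; suc)
open import Data.Integer using (+_)
open import Data.Rational as ℚ using (ℚ; 0ℚ)
open import Data.Bool using (Bool; true; false; if_then_else_)
open import Data.Fin using (Fin)
open import Data.Fin.Properties using (_≟_)
open import Data.Fin.Subset using (Subset; _∈_; _∉_; _⊆_; ∣_∣)
open import Data.Fin.Subset.Properties using (_∈?_)
open import Data.List using (List; []; _∷_; map; filter; foldr; allFin)
open import Data.List.Membership.DecPropositional using ()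
open import Data.Empty using (⊥)
open import Data.List.Relation.Unary.Unique.Propositional using (Unique)
open import Data.Product using (Σ; _×_; _,_; ∃)
open import Data.Sum using (_⊎_)
open import Relation.Nullary using (¬_; does)
open import Relation.Binary.PropositionalEquality using (_≡_; _≢_)

sumℕ : List ℕ → ℕ
sumℕ = foldr ℕ._+_ 0

sumℚ : List ℚ → ℚ
sumℚ = foldr ℚ._+_ 0ℚ

Σℕ : (k : ℕ) → (Fin k → ℕ) → ℕ
Σℕ k f = sumℕ (map f (allFin k))

Σℕ-over : {k : ℕ} → Subset k → (Fin k → ℕ) → ℕ
Σℕ-over {k} A f = sumℕ (map f (filter (_∈? A) (allFin k)))

toℚ : ℕ → ℚ
toℚ k = + k ℚ./ 1

record Network (n m : ℕ) : Set where
  field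
    tail head : Fin m → Fin n
    cap       : Fin m → ℕ
    S         : Subset n

module _ {n m : ℕ} (N : Network n m) where
  open Network N

  outCap inCap : Fin n → ℕ
  outCap v = Σℕ m (λ e → if does (tail e ≟ v) then cap e else 0)
  inCap  v = Σℕ m (λ e → if does (head e ≟ v) then cap e else 0)

  Eulerian : Fin n → Set
  Eulerian v = outCap v ≡ inCap v

  InnerEulerian : Set
  InnerEulerian = ∀ v → v ∉ S → Eulerian v

  cut : Subset n → ℕ
  cut X = Σℕ m (λ e → if does (tail e ∈? X) then
                         (if does (head e ∈? X) then 0 else cap e) else 0)

  IsWalk : Fin n → Fin n → List (Fin m) → Set
  IsWalk u v []       = u ≡ v
  IsWalk u v (e ∷ es) = tail e ≡ u × IsWalk (head e) v es

  walkNodes : Fin n → List (Fin m) → List (Fin n)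
  walkNodes u []       = u ∷ []
  walkNodes u (e ∷ es) = u ∷ walkNodes (head e) es

  IsPath : Fin n → Fin n → List (Fin m) → Set
  IsPath u v es = IsWalk u v es × Unique (walkNodes u es)

  record TPath : Set where
    field
      src tgt : Fin n
      edges   : List (Fin m)
      isPath  : IsPath src tgt edges
      src∈S   : src ∈ S
      tgt∈S   : tgt ∈ S
      src≢tgt : src ≢ tgt

  uses : Fin m → TPath → Bool
  uses e P = does (Data.List.Membership.DecPropositional._∈?_ _≟_ e (TPath.edges P))

  FracMultiflow : Set
  FracMultiflow = List (Σ TPath λ _ → ℚ)

  IntMultiflow : Set
  IntMultiflow = List (Σ TPath λ _ → ℕ)

  FracFeasible : FracMultiflow → Set
  FracFeasible F =
    (∀ {P w} → (P , w) ∈ₗ F → 0ℚ ℚ.≤ w) ×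
    (∀ e → sumℚ (map (λ { (P , w) → if uses e P then w else 0ℚ }) F) ℚ.≤ toℚ (cap e))
    where
    open import Data.List.Membership.Propositional renaming (_∈_ to _∈ₗ_)

  IntFeasible : IntMultiflow → Set
  IntFeasible F =
    ∀ e → sumℕ (map (λ { (P , w) → if uses e P then w else 0 }) F) ℕ.≤ cap e

  fracValue : (Fin n → Fin n → ℕ) → FracMultiflow → ℚ
  fracValue μ F = sumℚ (map (λ { (P , w) → w ℚ.* toℚ (μ (TPath.src P) (TPath.tgt P)) }) F)

  intValue : (Fin n → Fin n → ℕ) → IntMultiflow → ℕ
  intValue μ F = sumℕ (map (λ { (P , w) → w ℕ.* μ (TPath.src P) (TPath.tgt P) }) F)

module _ {n : ℕ} (S : Subset n) (H : Fin n → Fin n → Bool) where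

  Edge : Fin n → Fin n → Set
  Edge s t = H s t ≡ true

  SimpleOn : Set
  SimpleOn = (∀ s → H s s ≡ false) × (∀ s t → Edge s t → s ∈ S × t ∈ S)

  μ : Fin n → Fin n → ℕ
  μ s t = if H s t then 1 else 0

  deg : Fin n → ℕ
  deg s = Σℕ n (λ t → μ s t ℕ.+ μ t s)

  InN : Fin n → Fin n → Set
  InN s t = Edge s t ⊎ Edge t s

data QCType : Set where
  sink-type source-type : QCType

module _ {n : ℕ} (S : Subset n) (H : Fin n → Fin n → Bool) where

  QuasiComplete : Subset n → QCType → Set
  QuasiComplete T ty =
    SimpleOn S H × T ⊆ S ×
    (∀ s t → Edge S H s t → s ∈ T ⊎ t ∈ T) ×
    (∀ s t → s ∈ T → t ∈ T → s ≢ t → Edge S H s t) ×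
    cond2 ty
    where
    cond2 : QCType → Set
    cond2 sink-type   = ∀ s t → Edge S H s t → s ∉ T → t ∈ T → ⊥
    cond2 source-type = ∀ s t → Edge S H s t → s ∈ T → t ∉ T → ⊥

  CutAdmissible : QCType → Fin n → Subset n → Set
  CutAdmissible sink-type   s X = s ∈ X × (∀ t → InN S H s t → t ∉ X)
  CutAdmissible source-type s X = (∀ t → InN S H s t → t ∈ X) × s ∉ X

IsMinCut : {n m : ℕ} → Network n m → (Subset n → Set) → ℕ → Set
IsMinCut N Adm k =
  (∃ λ X → Adm X × cut N X ≡ k) × (∀ X → Adm X → k ℕ.≤ cut N X)

{-# OPTIONS --safe #-}
{-
Reversing all arcs exchanges the two types, so let H be sink-type.  Fix κ s as the minimum cuts.
Weak duality holds because a path counted by μ leaves the cut set of its endpoint in T.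

For the converse, view the network as a multiset of unit arcs, each carrying a walk of G, and
keep two invariants: every admissible set of s ∈ T has cut at least κ s, and a node outside the
neighbourhoods of two distinct members of T is Eulerian (the degree hypothesis says exactly this).
As long as some arc x runs from s ∈ T to a node v ≠ s outside N(s), either x can be deleted or x
can be joined with some arc v → w into one arc s → w.  The join decreases the cut of Z only if
 (i)  Z is a set of s with v ∉ Z and w ∈ Z, or
 (ii) Z is a set of some t ≠ s with v ∈ Z and w ∉ Z,
so it is blocked only by a tight such Z.  Tight sets of one terminal are closed under ∩ and ∪.
Tight sets Y, Z of distinct terminals uncross to tight sets Y ∖ Z, Z ∖ Y, and then no arc joins
Y ∩ Z to the complement of Y ∪ Z.  As x enters Y ∩ Z, a single t occurs in (ii); for its least
tight set Y ∋ v every w blocked by (i) or (ii) lies outside Y, and if every arc out of v left Y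
then Y ∖ {v} would violate the cut condition.  Without (ii), the greatest tight set X of s
avoiding v plays this role: if every arc out of v entered X, then X ∪ {v} would be too small.
When no such arc x is left, κ s ≤ cut {s} counts only arcs from s into N(s).
-}
module Submission where

open import Defs
open import Data.Nat using (ℕ; zero; suc; _+_; _*_; _≤_; _<_; z≤n; s≤s)
open import Data.Nat.Properties hiding (_≟_)
import Data.Nat.Properties as ℕ
open import Algebra.Bundles using (CommutativeMonoid)
open import Algebra.Properties.CommutativeSemigroup +-commutativeSemigroup using (interchange)
import Data.Integer as ℤ
import Data.Integer.Properties as ℤ
open import Data.Rational using (ℚ; 0ℚ) renaming (_≤_ to _≤ℚ_)
import Data.Rational as ℚ
import Data.Rational.Properties as ℚ
open import Algebra.Properties.CommutativeSemigroup (CommutativeMonoid.commutativeSemigroup ℚ.+-0-commutativeMonoid) using () renaming (interchange to ℚ-interchange)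
import Data.Rational.Unnormalised as ℚᵘ
import Data.Rational.Unnormalised.Properties as ℚᵘ
open import Data.Bool using (Bool; true; false; if_then_else_; _∧_; _∨_; not)
import Data.Bool.Properties as Bool
open import Data.Fin using (Fin; zero; suc)
import Data.Fin.Properties as Fin
open import Data.Fin.Properties using (_≟_)
open import Data.Fin.Subset using (Subset; _∈_; _∉_; ∣_∣; _∩_; _∪_; ∁)
open import Data.Fin.Subset.Properties using (_∈?_; x∈p⇒x∉∁p; x∉p⇒x∈∁p; anySubset?)
open import Data.Vec using ([]; _∷_; lookup; tabulate; zipWith)
open import Data.Vec.Properties using (lookup-map; lookup∘tabulate; lookup-zipWith; []=⇒lookup; lookup⇒[]=)
open import Data.List using (List; []; _∷_; _++_; map; filter; concatMap; replicate; allFin)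
open import Data.List.Properties using (map-tabulate)
import Data.List.Membership.Propositional as List
import Data.List.Membership.DecPropositional as DecList
open import Data.List.Relation.Unary.All using ([]; _∷_)
open import Data.List.Relation.Unary.All.Properties.Core using (¬Any⇒All¬)
open import Data.List.Relation.Unary.AllPairs using ([]; _∷_)
open import Data.List.Relation.Unary.Any using (here; there)
open import Data.List.Membership.Propositional.Properties using (∈-allFin; ∈-filter⁺; ∈-concatMap⁺)
open import Data.Product using (_×_; _,_; proj₁; proj₂; ∃; ∃₂; swap)
open import Data.Sum using (_⊎_; inj₁; inj₂) renaming (swap to ⊎-swap)
open import Data.Empty using (⊥; ⊥-elim)
open import Function using (_∘_; id; flip)
open import Relation.Nullary using (¬_; Dec; yes; no; does; contradiction)
open import Relation.Nullary.Decidable using (map′; toWitness; _×-dec_; _⊎-dec_; _→-dec_; ¬?; dec-true; dec-false)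
open import Relation.Binary.PropositionalEquality
import Relation.Binary.Reasoning.Setoid as SetoidReasoning

-- Sums over lists

tot : {A : Set} → (A → ℕ) → List A → ℕ
tot f L = sumℕ (map f L)

ind : Bool → ℕ
ind b = if b then 1 else 0

module _ {A : Set} where

  tot-mono : {f g : A → ℕ} → (∀ x → f x ≤ g x) → ∀ L → tot f L ≤ tot g L
  tot-mono f≤g []      = z≤n
  tot-mono f≤g (x ∷ L) = +-mono-≤ (f≤g x) (tot-mono f≤g L)

  tot-cong : {f g : A → ℕ} → (∀ x → f x ≡ g x) → ∀ L → tot f L ≡ tot g L
  tot-cong f≗g []      = refl
  tot-cong f≗g (x ∷ L) = cong₂ _+_ (f≗g x) (tot-cong f≗g L)

  tot-+ : (f g : A → ℕ) → ∀ L → tot (λ x → f x + g x) L ≡ tot f L + tot g L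
  tot-+ f g []      = refl
  tot-+ f g (x ∷ L) = trans (cong (f x + g x +_) (tot-+ f g L)) (interchange (f x) (g x) _ _)

  tot-0 : (L : List A) → tot (λ _ → 0) L ≡ 0
  tot-0 []      = refl
  tot-0 (x ∷ L) = tot-0 L

  tot-++ : (f : A → ℕ) → ∀ L M → tot f (L ++ M) ≡ tot f L + tot f M
  tot-++ f []      M = refl
  tot-++ f (x ∷ L) M = trans (cong (f x +_) (tot-++ f L M)) (sym (+-assoc (f x) _ _))

  tot-∈ : (f : A → ℕ) → ∀ {x L} → x List.∈ L → f x ≤ tot f L
  tot-∈ f (here refl) = m≤m+n _ _
  tot-∈ f (there x∈L) = ≤-trans (tot-∈ f x∈L) (m≤n+m _ _)

  tot-mono₂ : (f₁ f₂ g₁ g₂ : A → ℕ) → (∀ x → f₁ x + f₂ x ≤ g₁ x + g₂ x) →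
              ∀ L → tot f₁ L + tot f₂ L ≤ tot g₁ L + tot g₂ L
  tot-mono₂ f₁ f₂ g₁ g₂ h L = subst₂ _≤_ (tot-+ f₁ f₂ L) (tot-+ g₁ g₂ L) (tot-mono h L)

  -- Lists are compared as multisets, through the value of every additive functional.
  _≈_ : List A → List A → Set
  L ≈ M = ∀ f → tot f L ≡ tot f M

  -- Absence is returned as a vanishing sum, ready to be substituted into counting inequalities.
  pick : (p : A → Bool) → ∀ L →
         (∃₂ λ y M → p y ≡ true × L ≈ (y ∷ M)) ⊎ tot (ind ∘ p) L ≡ 0
  pick p [] = inj₂ refl
  pick p (x ∷ L) with p x in px
  ... | true  = inj₁ (x , L , px , λ _ → refl)
  ... | false with pick p L
  ...   | inj₂ none = inj₂ none
  ...   | inj₁ (y , M , py , L≈) = inj₁ (y , x ∷ M , py , λ f →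
            trans (cong (f x +_) (L≈ f)) (swap₃ (f x) (f y) _))
    where
    swap₃ : ∀ a b c → a + (b + c) ≡ b + (a + c)
    swap₃ a b c = trans (sym (+-assoc a b c)) (trans (cong (_+ c) (+-comm a b)) (+-assoc b a c))

tot-swap : {A B : Set} (h : A → B → ℕ) → ∀ L M →
           tot (λ x → tot (h x) M) L ≡ tot (λ y → tot (λ x → h x y) L) M
tot-swap h []      M = sym (tot-0 M)
tot-swap h (x ∷ L) M = trans (cong (tot (h x) M +_) (tot-swap h L M)) (sym (tot-+ (h x) _ M))

Σℕ-suc : ∀ {n} (f : Fin (suc n) → ℕ) → Σℕ (suc n) f ≡ f zero + Σℕ n (f ∘ suc)
Σℕ-suc f = cong (λ l → f zero + sumℕ l) (trans (map-tabulate suc f) (sym (map-tabulate id (f ∘ suc))))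

Σℕ-point : ∀ {n} (f : Fin n → ℕ) a → Σℕ n (λ v → if does (a ≟ v) then f v else 0) ≡ f a
Σℕ-point {suc n} f zero =
  trans (Σℕ-suc (λ v → if does (zero ≟ v) then f v else 0))
        (trans (cong (f zero +_) (tot-0 (allFin n))) (+-identityʳ _))
Σℕ-point {suc n} f (suc a) =
  trans (Σℕ-suc (λ v → if does (suc a ≟ v) then f v else 0)) (Σℕ-point (f ∘ suc) a)

-- One-arc inequalities and subset operations

∀Bool? : {P : Bool → Set} → (∀ b → Dec (P b)) → Dec (∀ b → P b)
∀Bool? P? = map′ (λ { (t , f) true → t ; (t , f) false → f }) (λ h → h true , h false)
                 (P? true ×-dec P? false)

-- The share of one arc in a directed cut: the arguments tell whether its start and its end lie in
-- the set.
lv : Bool → Bool → ℕ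
lv a b = ind (a ∧ not b)

lv-∩-∪ : ∀ a a′ b b′ → lv (a ∧ a′) (b ∧ b′) + lv (a ∨ a′) (b ∨ b′) ≤ lv a b + lv a′ b′
lv-∩-∪ = toWitness {a? = ∀Bool? λ _ → ∀Bool? λ _ → ∀Bool? λ _ → ∀Bool? λ _ → _ ℕ.≤? _} _

-- Passing to differences needs a correction: the numbers of arcs starting and ending in the
-- intersection, the last summands on the two sides, which cancel if the intersection is Eulerian.
-- The third term on the left counts arcs from outside both sets into the intersection.
lv-∖-∖ : ∀ a a′ b b′ →
         (lv (a ∧ not a′) (b ∧ not b′) + lv (a′ ∧ not a) (b′ ∧ not b)
           + ind (b ∧ b′ ∧ not a ∧ not a′)) + ind (a ∧ a′)
         ≤ (lv a b + lv a′ b′) + ind (b ∧ b′)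
lv-∖-∖ = toWitness {a? = ∀Bool? λ _ → ∀Bool? λ _ → ∀Bool? λ _ → ∀Bool? λ _ → _ ℕ.≤? _} _

module _ {n : ℕ} where

  _∖_ : Subset n → Subset n → Subset n
  _∖_ = zipWith (λ a b → a ∧ not b)

  lookup-∩ : ∀ Z W (v : Fin n) → lookup (Z ∩ W) v ≡ lookup Z v ∧ lookup W v
  lookup-∩ Z W v = lookup-zipWith _∧_ v Z W

  lookup-∪ : ∀ Z W (v : Fin n) → lookup (Z ∪ W) v ≡ lookup Z v ∨ lookup W v
  lookup-∪ Z W v = lookup-zipWith _∨_ v Z W

  lookup-∖ : ∀ Z W v → lookup (Z ∖ W) v ≡ lookup Z v ∧ not (lookup W v)
  lookup-∖ Z W v = lookup-zipWith (λ a b → a ∧ not b) v Z W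

  single : Fin n → Subset n
  single v = tabulate (λ u → does (u ≟ v))

  lookup-single : ∀ v u → lookup (single v) u ≡ does (u ≟ v)
  lookup-single v u = lookup∘tabulate _ u

  -- An extremal member of a family closed under ∪ (b = true) or ∩ (b = false).
  extremal : (P : Subset n → Set) → (∀ Z → Dec (P Z)) →
             (b : Bool) (_∙_ : Subset n → Subset n → Subset n) →
             (∀ Z W v → lookup Z v ≡ b ⊎ lookup W v ≡ b → lookup (Z ∙ W) v ≡ b) →
             (∀ Z W → P Z → P W → P (Z ∙ W)) →
             ∃ P → ∃ λ Z → P Z × (∀ W → P W → ∀ v → lookup W v ≡ b → lookup Z v ≡ b)
  extremal P P? b _∙_ absorb closed (Z₀ , PZ₀) =
    let Z , PZ , max = go (allFin n) in Z , PZ , λ W PW v Wv → max v (∈-allFin v) W PW Wv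
    where
    go : ∀ vs → ∃ λ Z → P Z × (∀ v → v List.∈ vs → ∀ W → P W → lookup W v ≡ b → lookup Z v ≡ b)
    go [] = Z₀ , PZ₀ , λ _ ()
    go (v ∷ vs) with go vs | anySubset? (λ W → P? W ×-dec (lookup W v Bool.≟ b))
    ... | Z , PZ , max | no none =
      Z , PZ , λ { _ (here refl) W PW Wv → contradiction (W , PW , Wv) none ; u (there u∈vs) → max u u∈vs }
    ... | Z , PZ , max | yes (W₁ , PW₁ , W₁v) =
      Z ∙ W₁ , closed Z W₁ PZ PW₁ ,
      λ { _ (here refl) _ _ _ → absorb Z W₁ v (inj₂ W₁v)
        ; u (there u∈vs) W PW Wu → absorb Z W₁ u (inj₁ (max u u∈vs W PW Wu)) }

does⇒≡ : ∀ {n} {u v : Fin n} → does (u ≟ v) ≡ true → u ≡ v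
does⇒≡ {u = u} {v} eq with u ≟ v
... | yes u≡v = u≡v

-- Adding a node to a set: `i` and `j` tell whether the arc starts or ends at that node. Arcs from
-- the set to it are saved; arcs from it to the outside are the price.
lv∪+ : ∀ p q i j → lv (p ∨ i) (q ∨ j) + ind (p ∧ j ∧ not q) ≤ lv p q + ind (i ∧ not q)
lv∪+ = toWitness {a? = ∀Bool? λ _ → ∀Bool? λ _ → ∀Bool? λ _ → ∀Bool? λ _ → _ ℕ.≤? _} _

-- Removing a node from a set containing it, whence the hypothesis. `ind i` and `ind j` sum to its
-- two degrees, which cancel if it is Eulerian.
lv∖+ : ∀ p q i j → (i ≡ true → p ≡ true) →
       (lv (p ∧ not i) (q ∧ not j) + ind i) + ind (j ∧ not p) ≤ (lv p q + ind j) + ind (i ∧ q)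
lv∖+ = toWitness {a? = ∀Bool? λ p → ∀Bool? λ _ → ∀Bool? λ i → ∀Bool? λ _ →
                       ((i Bool.≟ true) →-dec (p Bool.≟ true)) →-dec (_ ℕ.≤? _)} _

true≢false : ∀ {b} → b ≡ true → b ≡ false → ⊥
true≢false refl ()

-- Cut conditions, tight sets and uncrossing

-- Arcs are abstract so that the source type is obtained from the sink type by exchanging src and tgt.
module Splitting {n m : ℕ} {A : Set} (src tgt : A → Fin n) (cost : Fin m → A → ℕ)
  (join : ∀ x y → tgt x ≡ src y →
          ∃ λ z → src z ≡ src x × tgt z ≡ tgt y × (∀ e → cost e z ≡ cost e x + cost e y))
  (T : Subset n) (Nb : Fin n → Fin n → Bool) (κ : Fin n → ℕ)
  (Nb-irrefl : ∀ s → Nb s s ≡ false)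
  (Nb-T : ∀ {s t} → s ∈ T → t ∈ T → s ≢ t → Nb s t ≡ true) where

  -- The sets of the sink-type formula; those of the source type are the complements.
  Adm : Fin n → Subset n → Set
  Adm s Z = lookup Z s ≡ true × (∀ t → Nb s t ≡ true → lookup Z t ≡ false)

  leaves : Subset n → A → ℕ
  leaves Z x = lv (lookup Z (src x)) (lookup Z (tgt x))

  ∂ : Subset n → List A → ℕ
  ∂ Z = tot (leaves Z)

  starts ends : Fin n → A → ℕ
  starts v x = ind (does (src x ≟ v))
  ends   v x = ind (does (tgt x ≟ v))

  Eul : List A → Fin n → Set
  Eul L v = tot (starts v) L ≡ tot (ends v) L

  -- For `s` in `T`, `Valid` supplies the reverse inequality.
  Tight : List A → Fin n → Subset n → Set
  Tight L s Z = Adm s Z × ∂ Z L ≤ κ s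

  Tight? : ∀ L s Z → Dec (Tight L s Z)
  Tight? L s Z =
    ((lookup Z s Bool.≟ true) ×-dec
     Fin.all? (λ t → (Nb s t Bool.≟ true) →-dec (lookup Z t Bool.≟ false)))
    ×-dec (∂ Z L ℕ.≤? κ s)

  -- `eul` reaches every node that lies in admissible sets of two different members of `T`, which is
  -- what uncrossing such sets requires.
  record Valid (L : List A) : Set where
    field
      cuts : ∀ {s} → s ∈ T → ∀ Z → Adm s Z → κ s ≤ ∂ Z L
      eul  : ∀ {s t} → s ∈ T → t ∈ T → s ≢ t →
             ∀ v → Nb s v ≡ false → Nb t v ≡ false → Eul L v
  open Valid

  Adm⇒¬Nb : ∀ {s} Z → Adm s Z → ∀ v → lookup Z v ≡ true → Nb s v ≡ false
  Adm⇒¬Nb {s} Z adm v Zv with Nb s v in eq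
  ... | false = refl
  ... | true  = ⊥-elim (true≢false Zv (proj₂ adm v eq))

  Adm-∩ : ∀ {s} Z W → Adm s Z → Adm s W → Adm s (Z ∩ W)
  Adm-∩ {s} Z W (Zs , ZN) (Ws , _) =
    trans (lookup-∩ Z W s) (cong₂ _∧_ Zs Ws) ,
    λ t st → trans (lookup-∩ Z W t) (cong (_∧ lookup W t) (ZN t st))

  Adm-∪ : ∀ {s} Z W → Adm s Z → Adm s W → Adm s (Z ∪ W)
  Adm-∪ {s} Z W (Zs , ZN) (_ , WN) =
    trans (lookup-∪ Z W s) (cong (_∨ lookup W s) Zs) ,
    λ t st → trans (lookup-∪ Z W t) (cong₂ _∨_ (ZN t st) (WN t st))

  Adm-∖ : ∀ {s} Z W → Adm s Z → lookup W s ≡ false → Adm s (Z ∖ W)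
  Adm-∖ {s} Z W (Zs , ZN) Ws =
    trans (lookup-∖ Z W s) (cong₂ (λ a b → a ∧ not b) Zs Ws) ,
    λ t st → trans (lookup-∖ Z W t) (cong (_∧ not (lookup W t)) (ZN t st))

  foreign : ∀ {s t} Z → s ∈ T → t ∈ T → s ≢ t → Adm t Z → lookup Z s ≡ false
  foreign Z s∈T t∈T s≢t adm = proj₂ adm _ (Nb-T t∈T s∈T (s≢t ∘ sym))

  ∂-∩-∪ : ∀ L Z W → ∂ (Z ∩ W) L + ∂ (Z ∪ W) L ≤ ∂ Z L + ∂ W L
  ∂-∩-∪ L Z W = tot-mono₂ (leaves (Z ∩ W)) (leaves (Z ∪ W)) (leaves Z) (leaves W) arc L
    where
    arc : ∀ x → leaves (Z ∩ W) x + leaves (Z ∪ W) x ≤ leaves Z x + leaves W x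
    arc x rewrite lookup-∩ Z W (src x) | lookup-∩ Z W (tgt x)
                | lookup-∪ Z W (src x) | lookup-∪ Z W (tgt x) = lv-∩-∪ (lookup Z (src x)) _ _ _

  -- The arithmetic of uncrossing: of the total `k + l`, one new set takes at least `l`, so at most
  -- `k` is left for the other.
  squeeze : ∀ {a b c d k l} → a + b ≤ c + d → c ≤ k → d ≤ l → l ≤ b → a ≤ k
  squeeze {a} {l = l} h c≤k d≤l l≤b =
    +-cancelʳ-≤ l a _ (≤-trans (+-monoʳ-≤ a l≤b) (≤-trans h (+-mono-≤ c≤k d≤l)))

  module _ {L s} (V : Valid L) (s∈T : s ∈ T) where

    Tight-∩ : ∀ Z W → Tight L s Z → Tight L s W → Tight L s (Z ∩ W)
    Tight-∩ Z W (Za , Zt) (Wa , Wt) =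
      Adm-∩ Z W Za Wa , squeeze (∂-∩-∪ L Z W) Zt Wt (cuts V s∈T (Z ∪ W) (Adm-∪ Z W Za Wa))

    Tight-∪ : ∀ Z W → Tight L s Z → Tight L s W → Tight L s (Z ∪ W)
    Tight-∪ Z W (Za , Zt) (Wa , Wt) =
      Adm-∪ Z W Za Wa ,
      squeeze (subst (_≤ ∂ Z L + ∂ W L) (+-comm (∂ (Z ∩ W) L) _) (∂-∩-∪ L Z W))
              Zt Wt (cuts V s∈T (Z ∩ W) (Adm-∩ Z W Za Wa))

  -- The Eulerian equations are added over the nodes of `Z`, and the sums over arcs and nodes
  -- exchanged.
  Eul-sum : ∀ L Z → (∀ v → lookup Z v ≡ true → Eul L v) →
            tot (λ x → ind (lookup Z (src x))) L ≡ tot (λ x → ind (lookup Z (tgt x))) L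
  Eul-sum L Z eulZ =
    trans (expand src) (trans (tot-cong node (allFin n)) (sym (expand tgt)))
    where
    at : (A → Fin n) → Fin n → A → ℕ
    at f v x = if does (f x ≟ v) then ind (lookup Z v) else 0

    expand : ∀ f → tot (λ x → ind (lookup Z (f x))) L ≡ Σℕ n (λ v → tot (at f v) L)
    expand f = trans (tot-cong (λ x → sym (Σℕ-point (ind ∘ lookup Z) (f x))) L)
                     (tot-swap (λ x v → at f v x) L (allFin n))

    node : ∀ v → tot (at src v) L ≡ tot (at tgt v) L
    node v with lookup Z v in Zv
    ... | true  = eulZ v Zv
    ... | false = trans (vanish src) (sym (vanish tgt))
      where
      vanish : ∀ (f : A → Fin n) → tot (λ x → if does (f x ≟ v) then 0 else 0) L ≡ 0
      vanish f = trans (tot-cong (λ x → Bool.if-eta (does (f x ≟ v))) L) (tot-0 L)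

  enters∩ : Subset n → Subset n → A → ℕ
  enters∩ Z W x =
    ind (lookup Z (tgt x) ∧ lookup W (tgt x) ∧ not (lookup Z (src x)) ∧ not (lookup W (src x)))

  -- Both differences are admissible, so their cuts are at least `κ s` and `κ t`. Since `Z ∩ W` is
  -- Eulerian, these cuts and the entering arcs add up to at most `κ s + κ t`, which leaves no
  -- slack.
  uncross : ∀ {L s t} → Valid L → s ∈ T → t ∈ T → s ≢ t → ∀ Z W → Tight L s Z → Tight L t W →
            Tight L s (Z ∖ W) × tot (enters∩ Z W) L ≤ 0
  uncross {L} {s} {t} V s∈T t∈T s≢t Z W (Za , Zt) (Wa , Wt) =
    (admZ , squeeze (≤-trans (m≤m+n _ _) total) Zt Wt κt≤) ,
    -- The differences use up all of `κ s + κ t`; the bound 0 on `c` is what remains for the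
    -- entering arcs.
    squeeze {c = 0}
      (≤-trans (≤-reflexive (+-comm (tot (enters∩ Z W) L) (∂ (Z ∖ W) L + ∂ (W ∖ Z) L))) total)
      z≤n (+-mono-≤ Zt Wt) (+-mono-≤ κs≤ κt≤)
    where
    admZ = Adm-∖ Z W Za (foreign W s∈T t∈T s≢t Wa)
    admW = Adm-∖ W Z Wa (foreign Z t∈T s∈T (s≢t ∘ sym) Za)
    κs≤ = cuts V s∈T (Z ∖ W) admZ
    κt≤ = cuts V t∈T (W ∖ Z) admW

    arc : ∀ x → (leaves (Z ∖ W) x + leaves (W ∖ Z) x + enters∩ Z W x) + ind (lookup (Z ∩ W) (src x))
              ≤ (leaves Z x + leaves W x) + ind (lookup (Z ∩ W) (tgt x))
    arc x rewrite lookup-∖ Z W (src x) | lookup-∖ Z W (tgt x) | lookup-∖ W Z (src x)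
                | lookup-∖ W Z (tgt x) | lookup-∩ Z W (src x) | lookup-∩ Z W (tgt x) =
      lv-∖-∖ (lookup Z (src x)) _ _ _

    eul∩ : ∀ v → lookup (Z ∩ W) v ≡ true → Eul L v
    eul∩ v ZWv = eul V s∈T t∈T s≢t v (Adm⇒¬Nb Z Za v (Bool.∧-conicalˡ (lookup Z v) _ both))
                                     (Adm⇒¬Nb W Wa v (Bool.∧-conicalʳ (lookup Z v) _ both))
      where both = trans (sym (lookup-∩ Z W v)) ZWv

    total : ∂ (Z ∖ W) L + ∂ (W ∖ Z) L + tot (enters∩ Z W) L ≤ ∂ Z L + ∂ W L
    total = +-cancelʳ-≤ (tot (λ x → ind (lookup (Z ∩ W) (src x))) L) _ _
      (subst₂ _≤_
        (cong (_+ tot (λ x → ind (lookup (Z ∩ W) (src x))) L)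
          (trans (tot-+ (λ x → leaves (Z ∖ W) x + leaves (W ∖ Z) x) _ L)
                 (cong (_+ tot (enters∩ Z W) L) (tot-+ (leaves (Z ∖ W)) _ L))))
        (cong₂ _+_ (tot-+ (leaves Z) _ L) (sym (Eul-sum L (Z ∩ W) eul∩)))
        (tot-mono₂ (λ x → leaves (Z ∖ W) x + leaves (W ∖ Z) x + enters∩ Z W x) _
                   (λ x → leaves Z x + leaves W x) _ arc L))

  ∂-none : ∀ {L s Z} → Valid L → s ∈ T → Adm s Z → ¬ Tight L s Z → κ s < ∂ Z L
  ∂-none V s∈T adm ¬tight = ≰⇒> (λ ≤κ → ¬tight (adm , ≤κ))

  size : List A → ℕ
  size = tot (λ _ → 1)

  record Progress (L : List A) : Set where
    field
      next    : List A
      valid   : Valid next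
      smaller : size next < size L
      cheaper : ∀ e → tot (cost e) next ≤ tot (cost e) L

  -- Joining or deleting one arc

  module Step (x : A) (L₁ : List A) (V : Valid (x ∷ L₁)) (s∈T : src x ∈ T)
              (s≢v : src x ≢ tgt x) (¬sv : Nb (src x) (tgt x) ≡ false) where

    L = x ∷ L₁
    s = src x
    v = tgt x

    -- Obstruction (i): `s → v → w` leaves `Z` and returns, while the joined arc stays inside.
    Shortcut : Fin n → Set
    Shortcut w = ∃ λ Z → Tight L s Z × lookup Z v ≡ false × lookup Z w ≡ true

    -- Obstruction (ii): `s → v → w` enters and leaves `Z`, while the joined arc stays outside; `s`
    -- is outside as a neighbour of `t`.
    Detour : Fin n → Set
    Detour w = ∃₂ λ t Z → t ∈ T × s ≢ t × Tight L t Z × lookup Z v ≡ true × lookup Z w ≡ false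

    split : ∀ y M → L₁ ≈ (y ∷ M) → src y ≡ v → ¬ Shortcut (tgt y) → ¬ Detour (tgt y) → Progress L
    split y M L₁≈ yv ¬short ¬detour with join x y (sym yv)
    ... | z , z-src , z-tgt , z-cost = record
      { next = z ∷ M
      ; valid = record { cuts = cuts′ ; eul = eul′ }
      ; smaller = s≤s (≤-reflexive (sym (L₁≈ _)))
      ; cheaper = λ e → ≤-reflexive (trans (cong (_+ tot (cost e) M) (z-cost e))
                          (trans (+-assoc (cost e x) _ _) (sym (cong (cost e x +_) (L₁≈ (cost e))))))
      }
      where
      w = tgt y

      cuts′ : ∀ {t} → t ∈ T → ∀ Z → Adm t Z → κ t ≤ ∂ Z (z ∷ M)
      cuts′ {t} t∈T Z adm rewrite z-src | z-tgt = go _ _ _ refl refl refl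
        where
        eq : ∀ {p q r} → lookup Z s ≡ p → lookup Z v ≡ q → lookup Z w ≡ r →
             ∂ Z L ≡ lv p q + (lv q r + ∂ Z M)
        eq refl refl refl =
          trans (cong (leaves Z x +_) (L₁≈ (leaves Z)))
                (cong (λ u → leaves Z x + (lv (lookup Z u) (lookup Z w) + ∂ Z M)) yv)

        kept : κ t ≤ ∂ Z L
        kept = cuts V t∈T Z adm

        slack : ¬ Tight L t Z → κ t < ∂ Z L
        slack = ∂-none {Z = Z} V t∈T adm

        -- Only the patterns in-out-in and out-in-out of `s`, `v`, `w` lose an arc. There `Z` is not
        -- tight, and the strict inequality pays for the loss.
        go : ∀ p q r → lookup Z s ≡ p → lookup Z v ≡ q → lookup Z w ≡ r → κ t ≤ lv p r + ∂ Z M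
        go true true r Zs Zv Zw = subst (κ t ≤_) (eq Zs Zv Zw) kept
        go true false false Zs Zv Zw = subst (κ t ≤_) (eq Zs Zv Zw) kept
        go true false true Zs Zv Zw with s ≟ t
        ... | no s≢t = ⊥-elim (true≢false Zs (foreign Z s∈T t∈T s≢t adm))
        ... | yes refl =
          ≤-pred (subst (κ t <_) (eq Zs Zv Zw) (slack λ tight → ¬short (Z , tight , Zv , Zw)))
        go false false r Zs Zv Zw = subst (κ t ≤_) (eq Zs Zv Zw) kept
        go false true true Zs Zv Zw = subst (κ t ≤_) (eq Zs Zv Zw) kept
        go false true false Zs Zv Zw = ≤-pred (subst (κ t <_) (eq Zs Zv Zw) (slack λ tight →
          ¬detour (t , Z , t∈T , (λ { refl → true≢false (proj₁ adm) Zs }) , tight , Zv , Zw)))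

      cancel : ∀ a b c {S E} → a + (b + S) ≡ b + (c + E) → a + S ≡ c + E
      cancel a b c {S} {E} eq = +-cancelˡ-≡ b _ _ (trans (trans (sym (+-assoc b a S))
        (trans (cong (_+ S) (+-comm b a)) (+-assoc a b S))) eq)

      eul′ : ∀ {t t′} → t ∈ T → t′ ∈ T → t ≢ t′ → ∀ u → Nb t u ≡ false → Nb t′ u ≡ false → Eul (z ∷ M) u
      eul′ t∈T t′∈T t≢t′ u tu t′u rewrite z-src | z-tgt =
        -- `x` ends where `y` starts, so these two contributions cancel.
        cancel (starts u x) (ends u x) (ends u y)
          (subst (λ k → starts u x + (ind (does (k ≟ u)) + tot (starts u) M) ≡ ends u x + (ends u y + tot (ends u) M)) yv
            (trans (sym (cong (starts u x +_) (L₁≈ (starts u))))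
              (trans (eul V t∈T t′∈T t≢t′ u tu t′u) (cong (ends u x +_) (L₁≈ (ends u))))))

    -- Cuts that lose `x` belong to `s` and avoid `v`, so they are not tight. Degrees change at `s`
    -- and `v` only, and neither is in the reach of `eul`: `v` is not Eulerian, and `s` is adjacent
    -- to all other members of `T`.
    discard : (∀ Z → Tight L s Z → lookup Z v ≢ false) → ¬ Eul L v → Progress L
    discard ¬tight ¬eul = record
      { next = L₁ ; valid = record { cuts = cuts′ ; eul = eul′ } ; smaller = ≤-refl ; cheaper = λ e → m≤n+m _ _ }
      where
      cuts′ : ∀ {t} → t ∈ T → ∀ Z → Adm t Z → κ t ≤ ∂ Z L₁
      cuts′ {t} t∈T Z adm = go _ _ refl refl
        where
        eq : ∀ {p q} → lookup Z s ≡ p → lookup Z v ≡ q → ∂ Z L ≡ lv p q + ∂ Z L₁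
        eq refl refl = refl

        kept : κ t ≤ ∂ Z L
        kept = cuts V t∈T Z adm

        go : ∀ p q → lookup Z s ≡ p → lookup Z v ≡ q → κ t ≤ ∂ Z L₁
        go true false Zs Zv with s ≟ t
        ... | no s≢t = ⊥-elim (true≢false Zs (foreign Z s∈T t∈T s≢t adm))
        ... | yes refl = ≤-pred (subst (κ t <_) (eq Zs Zv)
                           (∂-none {Z = Z} V t∈T adm λ tight → ¬tight Z tight Zv))
        go true true Zs Zv = subst (κ t ≤_) (eq Zs Zv) kept
        go false q Zs Zv = subst (κ t ≤_) (eq Zs Zv) kept

      eul′ : ∀ {t t′} → t ∈ T → t′ ∈ T → t ≢ t′ → ∀ u → Nb t u ≡ false → Nb t′ u ≡ false → Eul L₁ u
      eul′ {t} {t′} t∈T t′∈T t≢t′ u tu t′u with eul V t∈T t′∈T t≢t′ u tu t′u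
      ... | eq with s ≟ u | v ≟ u
      ...   | _ | yes refl = ⊥-elim (¬eul (eul V t∈T t′∈T t≢t′ u tu t′u))
      ...   | no _ | no _ = eq
      ...   | yes refl | no _ with t ≟ s
      ...     | no t≢s = ⊥-elim (true≢false (Nb-T t∈T s∈T t≢s) tu)
      ...     | yes refl = ⊥-elim (true≢false (Nb-T t′∈T s∈T (t≢t′ ∘ sym)) t′u)

    from : (Bool → Bool) → Subset n → A → Bool
    from f Z y = does (src y ≟ v) ∧ f (lookup Z (tgt y))

    -- x itself does not start at v, so arcs out of v may be looked for in L₁ and counted in L.
    pickFrom : ∀ f Z → tot (ind ∘ from f Z) L ≢ 0 →
               (∀ y → src y ≡ v → f (lookup Z (tgt y)) ≡ true → ¬ Shortcut (tgt y) × ¬ Detour (tgt y)) →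
               Progress L
    pickFrom f Z some good with pick (from f Z) L₁
    ... | inj₁ (y , M , fy , L₁≈) =
      let yv = does⇒≡ (Bool.∧-conicalˡ _ _ fy)
          ok = good y yv (Bool.∧-conicalʳ (does (src y ≟ v)) _ fy)
      in split y M L₁≈ yv (proj₁ ok) (proj₂ ok)
    ... | inj₂ none = ⊥-elim (some (trans (cong (λ b → ind (b ∧ f (lookup Z v)) + tot (ind ∘ from f Z) L₁)
                                                 (dec-false (s ≟ v) s≢v)) none))

    -- Otherwise `X ∪ single v`, admissible as `v` is outside `N(s)`, gains no leaving arc and loses
    -- `x`, so its cut is below `κ s`.
    escape : ∀ X → Tight L s X → lookup X v ≡ false → tot (ind ∘ from not X) L ≢ 0
    escape X (adm , ∂≤) Xv none = 1+n≰n (≤-trans (≤-reflexive (+-comm 1 _)) (≤-trans (+-monoʳ-≤ (∂ (X ∪ single v) L) one)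
        (≤-trans total (≤-trans ∂≤ (cuts V s∈T (X ∪ single v) adm′)))))
      where
      adm′ : Adm s (X ∪ single v)
      adm′ = trans (lookup-∪ X (single v) s) (cong (_∨ lookup (single v) s) (proj₁ adm)) ,
             λ t st → trans (lookup-∪ X (single v) t) (cong₂ _∨_ (proj₂ adm t st)
               (trans (lookup-single v t) (dec-false (t ≟ v) λ { refl → true≢false st ¬sv })))

      back : A → ℕ
      back y = ind (lookup X (src y) ∧ does (tgt y ≟ v) ∧ not (lookup X (tgt y)))

      one : 1 ≤ tot back L
      one rewrite proj₁ adm | dec-true (v ≟ v) refl | Xv = s≤s z≤n

      arc : ∀ y → leaves (X ∪ single v) y + back y ≤ leaves X y + ind (from not X y)
      arc y rewrite lookup-∪ X (single v) (src y) | lookup-∪ X (single v) (tgt y)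
                  | lookup-single v (src y) | lookup-single v (tgt y) =
        lv∪+ (lookup X (src y)) (lookup X (tgt y)) (does (src y ≟ v)) _

      total : ∂ (X ∪ single v) L + tot back L ≤ ∂ X L
      total = subst (∂ (X ∪ single v) L + tot back L ≤_) (trans (cong (∂ X L +_) none) (+-identityʳ _)) 
        (tot-mono₂ (leaves (X ∪ single v)) back (leaves X) (ind ∘ from not X) arc L)

    -- Otherwise all arcs out of `v` leave `Y`, and deleting `v` from `Y` saves its whole out-degree
    -- and costs its in-degree less the arcs from outside `Y`, among them `x`. The degrees agree as
    -- `v` is outside `N(s)` and `N(t)`, so the cut is below `κ t`.
    remain : ∀ {t} Y → t ∈ T → s ≢ t → Tight L t Y → lookup Y v ≡ true → tot (ind ∘ from id Y) L ≢ 0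
    remain {t} Y t∈T s≢t (adm , ∂≤) Yv none = 1+n≰n (≤-trans (≤-reflexive (+-comm 1 _))
        (≤-trans (+-monoʳ-≤ (∂ (Y ∖ single v) L) one) (≤-trans total (≤-trans ∂≤ (cuts V t∈T (Y ∖ single v) adm′)))))
      where
      ¬tv : Nb t v ≡ false
      ¬tv = Adm⇒¬Nb Y adm v Yv

      adm′ : Adm t (Y ∖ single v)
      adm′ = Adm-∖ Y (single v) adm (trans (lookup-single v t)
               (dec-false (t ≟ v) λ { refl → true≢false (Nb-T s∈T t∈T s≢t) ¬sv }))

      fresh : A → ℕ
      fresh y = ind (does (tgt y ≟ v) ∧ not (lookup Y (src y)))

      one : 1 ≤ tot fresh L
      one rewrite dec-true (v ≟ v) refl | foreign Y s∈T t∈T s≢t adm = s≤s z≤n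

      arc : ∀ y → (leaves (Y ∖ single v) y + starts v y) + fresh y
                ≤ (leaves Y y + ends v y) + ind (from id Y y)
      arc y rewrite lookup-∖ Y (single v) (src y) | lookup-∖ Y (single v) (tgt y)
                  | lookup-single v (src y) | lookup-single v (tgt y) =
        lv∖+ (lookup Y (src y)) (lookup Y (tgt y)) (does (src y ≟ v)) (does (tgt y ≟ v))
             (λ yv → trans (cong (lookup Y) (does⇒≡ yv)) Yv)

      total : ∂ (Y ∖ single v) L + tot fresh L ≤ ∂ Y L
      total = +-cancelʳ-≤ (tot (starts v) L) _ _ (subst₂ _≤_
        (trans (cong (_+ tot fresh L) (tot-+ (leaves (Y ∖ single v)) _ L)) (swapʳ (∂ (Y ∖ single v) L) _ _))
        (trans (cong₂ _+_ (tot-+ (leaves Y) _ L) none)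
          (trans (+-identityʳ _) (cong (∂ Y L +_) (sym (eul V s∈T t∈T s≢t v ¬sv ¬tv)))))
        (tot-mono₂ (λ y → leaves (Y ∖ single v) y + starts v y) fresh
                   (λ y → leaves Y y + ends v y) (ind ∘ from id Y) arc L))
        where
        swapʳ : ∀ a b c → (a + b) + c ≡ (a + c) + b
        swapʳ a b c = trans (+-assoc a b c) (trans (cong (a +_) (+-comm b c)) (sym (+-assoc a c b)))

    progress : Progress L
    progress with Fin.any? (λ t → (t ∈? T) ×-dec ¬? (s ≟ t) ×-dec
                              anySubset? (λ Z → Tight? L t Z ×-dec (lookup Z v Bool.≟ true)))
    ... | yes (t , t∈T , s≢t , family) = pickFrom id Y (remain Y t∈T s≢t Yt Yv) good
      where
      P : Subset n → Set
      P Z = Tight L t Z × lookup Z v ≡ true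

      least = extremal P (λ Z → Tight? L t Z ×-dec (lookup Z v Bool.≟ true)) false _∩_
        (λ Z W u → λ { (inj₁ Zu) → trans (lookup-∩ Z W u) (cong (_∧ lookup W u) Zu)
                     ; (inj₂ Wu) → trans (lookup-∩ Z W u) (trans (cong (lookup Z u ∧_) Wu) (Bool.∧-zeroʳ _)) })
        (λ Z W (Zt , Zv) (Wt , Wv) → Tight-∩ V t∈T Z W Zt Wt , trans (lookup-∩ Z W v) (cong₂ _∧_ Zv Wv))
        family
      Y  = proj₁ least
      Yt = proj₁ (proj₁ (proj₂ least))
      Yv = proj₂ (proj₁ (proj₂ least))

      good : ∀ y → src y ≡ v → lookup Y (tgt y) ≡ true → ¬ Shortcut (tgt y) × ¬ Detour (tgt y)
      -- The difference of `Y` and `X` is tight by uncrossing and contains `v` but not the end of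
      -- `y`, against the minimality of `Y`.
      proj₁ (good y _ Yw) (X , Xt , Xv , Xw) = true≢false Yw (proj₂ (proj₂ least) (Y ∖ X)
        (proj₁ (uncross V t∈T s∈T (s≢t ∘ sym) Y X Yt Xt) ,
         trans (lookup-∖ Y X v) (cong₂ (λ a b → a ∧ not b) Yv Xv))
        (tgt y)
        (trans (lookup-∖ Y X (tgt y)) (trans (cong (λ b → lookup Y (tgt y) ∧ not b) Xw) (Bool.∧-zeroʳ _))))
      proj₂ (good y _ Yw) (t′ , Z , t′∈T , s≢t′ , Zt , Zv , Zw) with t ≟ t′
      ... | yes refl = true≢false Yw (proj₂ (proj₂ least) Z (Zt , Zv) (tgt y) Zw)
      -- `x` runs from outside both sets into their intersection, which uncrossing excludes.
      ... | no t≢t′ = 1+n≰n (≤-trans crossing (proj₂ (uncross V t∈T t′∈T t≢t′ Y Z Yt Zt)))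
        where
        crossing : 1 ≤ tot (enters∩ Y Z) L
        crossing rewrite Yv | Zv | foreign Y s∈T t∈T s≢t (proj₁ Yt)
                       | foreign Z s∈T t′∈T s≢t′ (proj₁ Zt) = s≤s z≤n
    ... | no ¬detour with anySubset? (λ Z → Tight? L s Z ×-dec (lookup Z v Bool.≟ false))
    ...   | yes family = pickFrom not X (escape X Xt Xv) (λ y _ ¬Xw →
              (λ (Z , Zt , Zv , Zw) → true≢false (proj₂ (proj₂ greatest) Z (Zt , Zv) (tgt y) Zw) (Bool.not-injective ¬Xw)) ,
              (λ (t , Z , t∈T , s≢t , Zt , Zv , _) → ¬detour (t , t∈T , s≢t , Z , Zt , Zv)))
      where
      P : Subset n → Set
      P Z = Tight L s Z × lookup Z v ≡ false

      greatest = extremal P (λ Z → Tight? L s Z ×-dec (lookup Z v Bool.≟ false)) true _∪_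
        (λ Z W u → λ { (inj₁ Zu) → trans (lookup-∪ Z W u) (cong (_∨ lookup W u) Zu)
                     ; (inj₂ Wu) → trans (lookup-∪ Z W u) (trans (cong (lookup Z u ∨_) Wu) (Bool.∨-zeroʳ _)) })
        (λ Z W (Zt , Zv) (Wt , Wv) → Tight-∪ V s∈T Z W Zt Wt , trans (lookup-∪ Z W v) (cong₂ _∨_ Zv Wv))
        family
      X  = proj₁ greatest
      Xt = proj₁ (proj₁ (proj₂ greatest))
      Xv = proj₂ (proj₁ (proj₂ greatest))
    ...   | no ¬short with tot (starts v) L ℕ.≟ tot (ends v) L
    ...     | no ¬eul = discard (λ Z Zt Zv → ¬short (Z , Zt , Zv)) ¬eul
    -- `x` enters the balanced node `v`, so some arc leaves it, and neither obstruction has a tight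
    -- set to offer.
    ...     | yes bal = pickFrom (λ _ → true) T some (λ _ _ _ →
                (λ (Z , Zt , Zv , _) → ¬short (Z , Zt , Zv)) ,
                (λ (t , Z , t∈T , s≢t , Zt , Zv , _) → ¬detour (t , t∈T , s≢t , Z , Zt , Zv)))
      where
      enter : 1 ≤ tot (ends v) L
      enter rewrite dec-true (v ≟ v) refl = s≤s z≤n

      some : tot (ind ∘ from (λ _ → true) T) L ≢ 0
      some none = 1+n≰n (≤-trans enter (≤-reflexive (trans (sym bal)
        (trans (tot-cong (λ y → cong ind (sym (Bool.∧-identityʳ (does (src y ≟ v))))) L) none))))

  -- Exhausting the bad arcs

  good : Fin n → A → Bool
  good s x = does (src x ≟ s) ∧ Nb s (tgt x)

  Valid-resp : ∀ {L M} → L ≈ M → Valid L → Valid M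
  Valid-resp L≈M V = record
    { cuts = λ s∈T Z adm → subst (_ ≤_) (L≈M (leaves Z)) (cuts V s∈T Z adm)
    ; eul = λ s∈T t∈T s≢t v sv tv → trans (sym (L≈M (starts v))) (trans (eul V s∈T t∈T s≢t v sv tv) (L≈M (ends v)))
    }

  bad : A → Bool
  bad x = lookup T (src x) ∧ not (does (src x ≟ tgt x)) ∧ not (Nb (src x) (tgt x))

  finished : ∀ L → Valid L → tot (ind ∘ bad) L ≡ 0 → ∀ {s} → s ∈ T → κ s ≤ tot (ind ∘ good s) L
  finished L V none {s} s∈T = ≤-trans (cuts V s∈T (single s) adm)
    (subst (∂ (single s) L ≤_) (trans (tot-+ (ind ∘ good s) _ L) (trans (cong (tot (ind ∘ good s) L +_) none) (+-identityʳ _)))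
      (tot-mono arc L))
    where
    adm : Adm s (single s)
    adm = trans (lookup-single s s) (dec-true (s ≟ s) refl) ,
          λ t st → trans (lookup-single s t) (dec-false (t ≟ s) λ { refl → true≢false st (Nb-irrefl s) })

    arc : ∀ x → leaves (single s) x ≤ ind (good s x) + ind (bad x)
    arc x rewrite lookup-single s (src x) | lookup-single s (tgt x) with src x ≟ s
    ... | no _ = z≤n
    ... | yes refl rewrite []=⇒lookup s∈T with src x ≟ tgt x | tgt x ≟ src x
    ...   | _ | yes _ = z≤n
    ...   | yes eq | no neq = contradiction (sym eq) neq
    ...   | no _ | no _ with Nb (src x) (tgt x)
    ...     | true  = s≤s z≤n
    ...     | false = s≤s z≤n

  Solution : List A → Set
  Solution L = ∃ λ M → (∀ e → tot (cost e) M ≤ tot (cost e) L) ×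
                       (∀ {s} → s ∈ T → κ s ≤ tot (ind ∘ good s) M)

  -- Induction on a bound for the number of arcs, which each step lowers; `≈` lets the bad arc be
  -- moved to the front.
  solve : ∀ k L → size L ≤ k → Valid L → Solution L
  solve k L L≤k V with pick bad L
  ... | inj₂ none = L , (λ _ → ≤-refl) , finished L V none
  solve zero L L≤k V | inj₁ (x , M , _ , L≈) =
    ⊥-elim (1+n≰n (≤-trans (subst (1 ≤_) (sym (L≈ (λ _ → 1))) (s≤s z≤n)) L≤k))
  solve (suc k) L L≤k V | inj₁ (x , M , bx , L≈) =
    let W , W≤ , full = solve k (Progress.next pr)
                          (≤-pred (≤-trans (Progress.smaller pr) (subst (_≤ suc k) (L≈ (λ _ → 1)) L≤k)))
                          (Progress.valid pr)
    in W , (λ e → ≤-trans (W≤ e) (≤-trans (Progress.cheaper pr e) (≤-reflexive (sym (L≈ (cost e)))))) , full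
    where
    rest = Bool.∧-conicalʳ (lookup T (src x)) _ bx
    s≢v : src x ≢ tgt x
    s≢v eq = true≢false (dec-true (src x ≟ tgt x) eq) (Bool.not-injective (Bool.∧-conicalˡ _ _ rest))
    pr = Step.progress x M (Valid-resp L≈ V) (lookup⇒[]= (src x) T (Bool.∧-conicalˡ _ _ bx)) s≢v
           (Bool.not-injective (Bool.∧-conicalʳ (not (does (src x ≟ tgt x))) _ rest))

-- Counting in subsets and expanded lists

does-∈? : ∀ {n} (X : Subset n) v → does (v ∈? X) ≡ lookup X v
does-∈? (true  ∷ X) zero    = refl
does-∈? (false ∷ X) zero    = refl
does-∈? (_ ∷ X)     (suc v) = does-∈? X v

∣∣-Σℕ : ∀ {n} (X : Subset n) → ∣ X ∣ ≡ Σℕ n (ind ∘ lookup X)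
∣∣-Σℕ []          = refl
∣∣-Σℕ (true  ∷ X) = trans (cong suc (∣∣-Σℕ X)) (sym (Σℕ-suc (ind ∘ lookup (true ∷ X))))
∣∣-Σℕ (false ∷ X) = trans (∣∣-Σℕ X) (sym (Σℕ-suc (ind ∘ lookup (false ∷ X))))

tot-filter : {A : Set} {P : A → Set} (P? : ∀ x → Dec (P x)) (f : A → ℕ) → ∀ L →
             tot f (filter P? L) ≡ tot (λ x → if does (P? x) then f x else 0) L
tot-filter P? f [] = refl
tot-filter P? f (x ∷ L) with does (P? x)
... | true  = cong (f x +_) (tot-filter P? f L)
... | false = tot-filter P? f L

tot-concatMap : {A B : Set} (f : B → ℕ) (g : A → List B) → ∀ L →
                tot f (concatMap g L) ≡ tot (λ x → tot f (g x)) L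
tot-concatMap f g []      = refl
tot-concatMap f g (x ∷ L) = trans (tot-++ f (g x) _) (cong (tot f (g x) +_) (tot-concatMap f g L))

tot-replicate : {A : Set} (f : A → ℕ) → ∀ k x → tot f (replicate k x) ≡ k * f x
tot-replicate f zero    x = refl
tot-replicate f (suc k) x = cong (f x +_) (tot-replicate f k x)

Σℕ-over-if : ∀ {n} (T : Subset n) f → Σℕ-over T f ≡ Σℕ n (λ s → if lookup T s then f s else 0)
Σℕ-over-if {n} T f = trans (tot-filter (_∈? T) f (allFin n))
  (tot-cong (λ s → cong (if_then f s else 0) (does-∈? T s)) (allFin n))

*-ind : ∀ k b → k * ind b ≡ (if b then k else 0)
*-ind k true  = *-identityʳ k
*-ind k false = *-zeroʳ k

-- Quasi-complete digraphs of sink type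

adj : ∀ {n} → (Fin n → Fin n → Bool) → Fin n → Fin n → Bool
adj H s t = H s t ∨ H t s

module _ {n : ℕ} {S : Subset n} {H : Fin n → Fin n → Bool} {T : Subset n}
         (qc : QuasiComplete S H T sink-type) where

  H-irrefl   = proj₁ (proj₁ qc)
  H-incident = proj₁ (proj₂ (proj₂ qc))
  H-complete = proj₁ (proj₂ (proj₂ (proj₂ qc)))
  H-sink     = proj₂ (proj₂ (proj₂ (proj₂ qc)))

  adj-irrefl : ∀ s → adj H s s ≡ false
  adj-irrefl s rewrite H-irrefl s = refl

  adj-T : ∀ {s t} → s ∈ T → t ∈ T → s ≢ t → adj H s t ≡ true
  adj-T {s} {t} s∈T t∈T s≢t rewrite H-complete s t s∈T t∈T s≢t = refl

  tail∈T : ∀ {a b} → H a b ≡ true → a ∈ T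
  tail∈T {a} {b} ab with a ∈? T | H-incident a b ab
  ... | yes a∈T | _ = a∈T
  ... | no a∉T  | inj₁ a∈T = a∈T
  ... | no a∉T  | inj₂ b∈T = ⊥-elim (H-sink a b ab a∉T b∈T)

  -- An edge from `b` to `a` also starts in `T`, so completeness provides its reverse.
  adj-out : ∀ {a b} → a ∈ T → adj H a b ≡ true → H a b ≡ true
  adj-out {a} {b} a∈T ab with H a b in eq
  ... | true  = refl
  ... | false with a ≟ b
  ...   | yes refl = trans (sym eq) ab
  ...   | no a≢b   = trans (sym eq) (H-complete a b a∈T (tail∈T ab) a≢b)

  -- A member of `T` is adjacent to `s` or `t`, so `v` is outside `T`. Its edges then come from
  -- members of `T` other than `s` and `t`, at most one from each.
  deg-missed : ∀ {s t} → s ∈ T → t ∈ T → s ≢ t →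
               ∀ v → adj H s v ≡ false → adj H t v ≡ false → deg S H v + 2 ≤ ∣ T ∣
  deg-missed {s} {t} s∈T t∈T s≢t v sv tv =
    subst₂ _≤_ (cong (deg S H v +_) (trans (tot-+ (λ u → ind (does (s ≟ u))) _ (allFin n))
                  (cong₂ _+_ (Σℕ-point (λ _ → 1) s) (Σℕ-point (λ _ → 1) t))))
               (sym (trans (∣∣-Σℕ T) (sym (trans (cong (Σℕ n (ind ∘ lookup T) +_) (tot-0 (allFin n))) (+-identityʳ _)))))
      (tot-mono₂ (λ u → μ S H v u + μ S H u v) (λ u → ind (does (s ≟ u)) + ind (does (t ≟ u)))
                 (ind ∘ lookup T) (λ _ → 0) node (allFin n))
    where
    v∉T : v ∉ T
    v∉T v∈T with s ≟ v
    ... | no s≢v = true≢false (adj-T s∈T v∈T s≢v) sv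
    ... | yes refl = true≢false (adj-T t∈T v∈T (s≢t ∘ sym)) tv

    vu : ∀ u → H v u ≡ false
    vu u with H v u in eq
    ... | false = refl
    ... | true  = contradiction (tail∈T eq) v∉T

    node : ∀ u → (μ S H v u + μ S H u v) + (ind (does (s ≟ u)) + ind (does (t ≟ u))) ≤ ind (lookup T u) + 0
    node u rewrite vu u with H u v in eq | s ≟ u | t ≟ u
    ... | true  | yes refl | _ rewrite eq = contradiction sv λ ()
    ... | true  | no _ | yes refl rewrite eq = contradiction tv λ ()
    ... | true  | no _ | no _ rewrite []=⇒lookup (tail∈T eq) = ≤-refl
    ... | false | yes s≡u | yes t≡u = contradiction (trans s≡u (sym t≡u)) s≢t
    ... | false | yes refl | no _ rewrite []=⇒lookup s∈T = ≤-refl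
    ... | false | no _ | yes refl rewrite []=⇒lookup t∈T = ≤-refl
    ... | false | no _ | no _ = z≤n

-- From capacities to joined unit arcs

module Packing {n m : ℕ} {A : Set} (src tgt : A → Fin n) (cost : Fin m → A → ℕ)
  (join : ∀ x y → tgt x ≡ src y →
          ∃ λ z → src z ≡ src x × tgt z ≡ tgt y × (∀ e → cost e z ≡ cost e x + cost e y))
  (unit : Fin m → A) (cost-unit : ∀ e e′ → cost e (unit e′) ≡ ind (does (e ≟ e′)))
  (cap : Fin m → ℕ) where

  volume : (A → ℕ) → ℕ
  volume f = Σℕ m (λ e → cap e * f (unit e))

  arcs : List A
  arcs = concatMap (λ e → replicate (cap e) (unit e)) (allFin m)

  tot-arcs : ∀ f → tot f arcs ≡ volume f
  tot-arcs f = trans (tot-concatMap f (λ e → replicate (cap e) (unit e)) (allFin m))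
                     (tot-cong (λ e → tot-replicate f (cap e) (unit e)) (allFin m))

  -- Each final arc is credited to its start alone, so adding the guarantees `κ s` over `T` counts
  -- it at most once. An arc from a member of `T` to one of its neighbours follows an edge of `H`.
  packing : ∀ {S H T} → QuasiComplete S H T sink-type → ∀ κ →
    (∀ {s} → s ∈ T → ∀ Z → lookup Z s ≡ true × (∀ t → adj H s t ≡ true → lookup Z t ≡ false) →
      κ s ≤ volume (λ x → lv (lookup Z (src x)) (lookup Z (tgt x)))) →
    (∀ v → deg S H v + 2 ≤ ∣ T ∣ →
      volume (λ x → ind (does (src x ≟ v))) ≡ volume (λ x → ind (does (tgt x ≟ v)))) →
    ∃ λ M → (∀ e → tot (cost e) M ≤ cap e) × Σℕ-over T κ ≤ tot (λ x → ind (H (src x) (tgt x))) M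
  packing {S} {H} {T} qc κ cuts eul = M , cheap , value
    where
    open module Core = Splitting src tgt cost join T (adj H) κ (adj-irrefl qc) (adj-T qc)
      using (Valid; solve; good; size)

    valid : Valid arcs
    valid = record
      { cuts = λ s∈T Z adm → subst (κ _ ≤_) (sym (tot-arcs _)) (cuts s∈T Z adm)
      ; eul  = λ s∈T t∈T s≢t v sv tv →
          trans (tot-arcs _) (trans (eul v (deg-missed qc s∈T t∈T s≢t v sv tv)) (sym (tot-arcs _)))
      }

    solution = solve (size arcs) arcs ≤-refl valid
    M = proj₁ solution

    cheap : ∀ e → tot (cost e) M ≤ cap e
    cheap e = ≤-trans (proj₁ (proj₂ solution) e) (≤-reflexive (trans (tot-arcs (cost e))
      (trans (tot-cong (λ e′ → trans (cong (cap e′ *_) (cost-unit e e′)) (*-ind (cap e′) _)) (allFin m))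
             (Σℕ-point cap e))))

    at : A → Fin n → ℕ
    at x s = if lookup T s then ind (good s x) else 0

    bound : ∀ s → (if lookup T s then κ s else 0) ≤ tot (λ x → at x s) M
    bound s with lookup T s in eq
    ... | true  = proj₂ (proj₂ solution) (lookup⇒[]= s T eq)
    ... | false = z≤n

    point : ∀ x → Σℕ n (at x) ≤ ind (H (src x) (tgt x))
    point x = ≤-trans (≤-reflexive (trans (tot-cong same (allFin n)) (Σℕ-point f (src x)))) final
      where
      f : Fin n → ℕ
      f s = if lookup T s then ind (adj H s (tgt x)) else 0

      same : ∀ s → at x s ≡ (if does (src x ≟ s) then f s else 0)
      same s with does (src x ≟ s)
      ... | true  = refl
      ... | false = Bool.if-eta (lookup T s)

      final : f (src x) ≤ ind (H (src x) (tgt x))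
      final with lookup T (src x) in eq
      ... | false = z≤n
      ... | true with adj H (src x) (tgt x) in sv
      ...   | false = z≤n
      ...   | true rewrite adj-out qc (lookup⇒[]= (src x) T eq) sv = ≤-refl

    value : Σℕ-over T κ ≤ tot (λ x → ind (H (src x) (tgt x))) M
    value = ≤-trans (≤-reflexive (Σℕ-over-if T κ))
      (≤-trans (tot-mono bound (allFin n))
        (≤-trans (≤-reflexive (sym (tot-swap at M (allFin n)))) (tot-mono point M)))

-- Walks, paths and integral multiflows

module _ {n m : ℕ} (N : Network n m) where
  open Network N

  -- Walks may repeat nodes and edges, so joining is concatenation; they are shortened to paths only
  -- when the multiflow is formed.
  record Walk : Set where
    constructor walk
    field
      {from to} : Fin n
      edges     : List (Fin m)
      isWalk    : IsWalk N from to edges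
  open Walk

  count : Fin m → Walk → ℕ
  count e x = tot (λ e′ → ind (does (e ≟ e′))) (edges x)

  unit : Fin m → Walk
  unit e = walk (e ∷ []) (refl , refl)

  count-unit : ∀ e e′ → count e (unit e′) ≡ ind (does (e ≟ e′))
  count-unit e e′ = +-identityʳ _

  IsWalk-++ : ∀ {u v w} es fs → IsWalk N u v es → IsWalk N v w fs → IsWalk N u w (es ++ fs)
  IsWalk-++ []       fs refl        q = q
  IsWalk-++ (e ∷ es) fs (tail≡ , p) q = tail≡ , IsWalk-++ es fs p q

  concat : ∀ x y → to x ≡ from y →
           ∃ λ z → from z ≡ from x × to z ≡ to y × (∀ e → count e z ≡ count e x + count e y)
  concat x y refl = walk (edges x ++ edges y) (IsWalk-++ (edges x) _ (isWalk x) (isWalk y)) ,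
                    refl , refl , λ e → tot-++ _ (edges x) (edges y)

  suffix : ∀ {u v w} es → IsPath N u v es → w List.∈ walkNodes N u es →
           ∃ λ fs → IsPath N w v fs × (∀ {e} → e List.∈ fs → e List.∈ es)
  suffix []       p                        (here refl) = [] , p , id
  suffix (e ∷ es) p                        (here refl) = e ∷ es , p , id
  suffix (e ∷ es) ((_ , p) , (_ ∷ unique)) (there w∈)  =
    let fs , q , fs⊆ = suffix es (p , unique) w∈ in fs , q , there ∘ fs⊆

  -- If `u` recurs on the path of the remaining walk, the path is cut to start at that recurrence.
  toPath : ∀ {u v} es → IsWalk N u v es →
           ∃ λ fs → IsPath N u v fs × (∀ {e} → e List.∈ fs → e List.∈ es)
  toPath []       refl       = [] , (refl , [] ∷ []) , λ ()
  toPath {u} (e ∷ es) (refl , p) with toPath es p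
  ... | fs , (q , unique) , fs⊆ with DecList._∈?_ _≟_ u (walkNodes N (head e) fs)
  ...   | yes u∈ = let gs , r , gs⊆ = suffix fs (q , unique) u∈ in gs , r , there ∘ fs⊆ ∘ gs⊆
  ...   | no u∉  = e ∷ fs , ((refl , q) , ¬Any⇒All¬ _ u∉ ∷ unique) ,
                   λ { (here eq) → here eq ; (there e∈) → there (fs⊆ e∈) }

  crossing : ∀ X {u v} es → IsWalk N u v es → u ∈ X → v ∉ X →
             ∃ λ e → e List.∈ es × tail e ∈ X × head e ∉ X
  crossing X []       refl       u∈X v∉X = contradiction u∈X v∉X
  crossing X (e ∷ es) (refl , p) u∈X v∉X with head e ∈? X
  ... | no h∉X  = e , here refl , u∈X , h∉X
  ... | yes h∈X = let e′ , e′∈ , c = crossing X es p h∈X v∉X in e′ , there e′∈ , c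

  module _ {H : Fin n → Fin n → Bool} (simple : SimpleOn S H) where

    -- A walk between the ends of an edge of `H` yields a path of weight 1. Its load is bounded by
    -- multiplicities in the walk, as shortening adds no edges.
    multiflow : ∀ M k → k ≤ tot (λ x → ind (H (from x) (to x))) M →
                ∃ λ (F : IntMultiflow N) → intValue N (μ S H) F ≡ k ×
                  (∀ e → sumℕ (map (λ { (P , w) → if uses N e P then w else 0 }) F) ≤ tot (count e) M)
    -- Dropping the remaining walks makes the value exactly `k`.
    multiflow M zero _ = [] , refl , λ _ → z≤n
    multiflow (x ∷ M) (suc k) k≤ with H (from x) (to x) in xH
    ... | false = let F , val , load = multiflow M (suc k) k≤
                  in F , val , λ e → ≤-trans (load e) (m≤n+m _ (count e x))
    ... | true  =
      let F , val , load = multiflow M k (≤-pred k≤)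
          fs , isPath , fs⊆ = toPath (edges x) (isWalk x)
          P = record { src = from x ; tgt = to x ; edges = fs ; isPath = isPath
                     ; src∈S = proj₁ (proj₂ simple _ _ xH) ; tgt∈S = proj₂ (proj₂ simple _ _ xH)
                     ; src≢tgt = λ eq → true≢false xH (trans (cong (H (from x)) (sym eq)) (proj₁ simple _)) }
      in (P , 1) ∷ F , cong₂ (λ b l → (ind b + 0) + l) xH val ,
         λ e → +-mono-≤ (once e P (λ e∈ → fs⊆ e∈)) (load e)
      where
      once : ∀ e (P : TPath N) → (e List.∈ TPath.edges P → e List.∈ edges x) →
             (if uses N e P then 1 else 0) ≤ count e x
      once e P ⊆x with DecList._∈?_ _≟_ e (TPath.edges P)
      ... | no _   = z≤n
      ... | yes e∈ = subst (_≤ count e x) (cong ind (dec-true (e ≟ e) refl))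
                       (tot-∈ (λ e′ → ind (does (e ≟ e′))) (⊆x e∈))

-- Rational sums and weak duality

toℚ-+ : ∀ a b → toℚ (a + b) ≡ toℚ a ℚ.+ toℚ b
toℚ-+ a b = ℚ.toℚᵘ-injective (begin
  ℚ.toℚᵘ (toℚ (a + b))                ≈⟨ ℚ.toℚᵘ-fromℚᵘ (frac (a + b)) ⟩
  frac (a + b)                        ≈⟨ ℚᵘ.*≡* (cong (ℤ._* ℤ.+ 1) (sym (cong₂ ℤ._+_ (ℤ.*-identityʳ (ℤ.+ a)) (ℤ.*-identityʳ (ℤ.+ b))))) ⟩
  frac a ℚᵘ.+ frac b                  ≈⟨ ℚᵘ.+-cong (ℚ.toℚᵘ-fromℚᵘ (frac a)) (ℚ.toℚᵘ-fromℚᵘ (frac b)) ⟨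
  ℚ.toℚᵘ (toℚ a) ℚᵘ.+ ℚ.toℚᵘ (toℚ b)  ≈⟨ ℚ.toℚᵘ-homo-+ (toℚ a) (toℚ b) ⟨
  ℚ.toℚᵘ (toℚ a ℚ.+ toℚ b)            ∎)
  where
  open SetoidReasoning ℚᵘ.≃-setoid
  frac : ℕ → ℚᵘ.ℚᵘ
  -- `mkℚᵘ` takes the denominator minus one.
  frac k = ℚᵘ.mkℚᵘ (ℤ.+ k) 0

module _ {A : Set} where

  sumℚ-mono : {f g : A → ℚ} → (∀ x → f x ≤ℚ g x) → ∀ L → sumℚ (map f L) ≤ℚ sumℚ (map g L)
  sumℚ-mono f≤g []      = ℚ.≤-refl
  sumℚ-mono f≤g (x ∷ L) = ℚ.+-mono-≤ (f≤g x) (sumℚ-mono f≤g L)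

  sumℚ-+ : (f g : A → ℚ) → ∀ L →
           sumℚ (map (λ x → f x ℚ.+ g x) L) ≡ sumℚ (map f L) ℚ.+ sumℚ (map g L)
  sumℚ-+ f g []      = refl
  sumℚ-+ f g (x ∷ L) = trans (cong (f x ℚ.+ g x ℚ.+_) (sumℚ-+ f g L)) (ℚ-interchange (f x) (g x) _ _)

  sumℚ-toℚ : (f : A → ℕ) → ∀ L → sumℚ (map (toℚ ∘ f) L) ≡ toℚ (tot f L)
  sumℚ-toℚ f []      = refl
  sumℚ-toℚ f (x ∷ L) = trans (cong (toℚ (f x) ℚ.+_) (sumℚ-toℚ f L)) (sym (toℚ-+ (f x) _))

  sumℚ-≥0 : {f : A → ℚ} → (∀ x → 0ℚ ≤ℚ f x) → ∀ L → 0ℚ ≤ℚ sumℚ (map f L)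
  sumℚ-≥0 f≥0 []      = ℚ.≤-refl
  sumℚ-≥0 f≥0 (x ∷ L) = ℚ.+-mono-≤ (f≥0 x) (sumℚ-≥0 f≥0 L)

  sumℚ-∈ : {f : A → ℚ} → (∀ x → 0ℚ ≤ℚ f x) → ∀ {x L} → x List.∈ L → f x ≤ℚ sumℚ (map f L)
  sumℚ-∈ {f} f≥0 {L = x ∷ L} (here refl) =
    ℚ.≤-trans (ℚ.≤-reflexive (sym (ℚ.+-identityʳ (f x)))) (ℚ.+-mono-≤ (ℚ.≤-refl {f x}) (sumℚ-≥0 f≥0 L))
  sumℚ-∈ {f} f≥0 {x} (there x∈L) =
    ℚ.≤-trans (ℚ.≤-reflexive (sym (ℚ.+-identityˡ (f x)))) (ℚ.+-mono-≤ (f≥0 _) (sumℚ-∈ f≥0 x∈L))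

module _ {n m : ℕ} (N : Network n m) where
  open Network N

  load : Fin m → FracMultiflow N → ℚ
  load e F = sumℚ (map (λ { (P , w) → if uses N e P then w else 0ℚ }) F)

  module _ {H : Fin n → Fin n → Bool} (Q : List (Fin m))
           (covers : ∀ (P : TPath N) → H (TPath.src P) (TPath.tgt P) ≡ true →
                     ∃ λ e → e List.∈ TPath.edges P × e List.∈ Q) where

    -- Every path that counts meets `Q`, so its weight occurs in the load of some edge of `Q`.
    fracValue≤load : ∀ F → (∀ {P w} → (P , w) List.∈ F → 0ℚ ≤ℚ w) →
                     fracValue N (μ S H) F ≤ℚ sumℚ (map (λ e → load e F) Q)
    fracValue≤load [] _ = sumℚ-≥0 (λ _ → ℚ.≤-refl) Q
    fracValue≤load ((P , w) ∷ F) w≥0 =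
      ℚ.≤-trans (ℚ.+-mono-≤ one (fracValue≤load F (w≥0 ∘ there)))
                (ℚ.≤-reflexive (sym (sumℚ-+ share (λ e → load e F) Q)))
      where
      share : Fin m → ℚ
      share e = if uses N e P then w else 0ℚ

      share≥0 : ∀ e → 0ℚ ≤ℚ share e
      share≥0 e with uses N e P
      ... | true  = w≥0 (here refl)
      ... | false = ℚ.≤-refl

      one : w ℚ.* toℚ (μ S H (TPath.src P) (TPath.tgt P)) ≤ℚ sumℚ (map share Q)
      one with H (TPath.src P) (TPath.tgt P) in PH
      ... | false = ℚ.≤-trans (ℚ.≤-reflexive (ℚ.*-zeroʳ w)) (sumℚ-≥0 share≥0 Q)
      ... | true  = let e , e∈P , e∈Q = covers P PH in
        ℚ.≤-trans (ℚ.≤-reflexive (trans (ℚ.*-identityʳ w)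
                     (cong (if_then w else 0ℚ) (sym (dec-true (DecList._∈?_ _≟_ e (TPath.edges P)) e∈P)))))
                  (sumℚ-∈ share≥0 e∈Q)

  crosses? : ∀ X e → Dec (tail e ∈ X × head e ∉ X)
  crosses? X e = (tail e ∈? X) ×-dec ¬? (head e ∈? X)

  cutEdges : Subset n → List (Fin m)
  cutEdges X = filter (crosses? X) (allFin m)

  tot-cutEdges : ∀ X → tot cap (cutEdges X) ≡ cut N X
  tot-cutEdges X = trans (tot-filter (crosses? X) cap (allFin m)) (tot-cong same (allFin m))
    where
    same : ∀ e → (if does (tail e ∈? X) ∧ not (does (head e ∈? X)) then cap e else 0)
               ≡ (if does (tail e ∈? X) then (if does (head e ∈? X) then 0 else cap e) else 0)
    same e with does (tail e ∈? X) | does (head e ∈? X)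
    ... | true  | true  = refl
    ... | true  | false = refl
    ... | false | _     = refl

  module _ {H : Fin n → Fin n → Bool} (T : Subset n) (X : Fin n → Subset n)
           (separated : ∀ {a b} → H a b ≡ true → ∃ λ s → s ∈ T × a ∈ X s × b ∉ X s) where

    -- An edge in several of the cuts is listed in `Q` once for each, in agreement with the sum of
    -- the cuts.
    weakDuality : ∀ F → FracFeasible N F →
                  fracValue N (μ S H) F ≤ℚ toℚ (Σℕ-over T (λ s → cut N (X s)))
    weakDuality F (w≥0 , load≤) = ℚ.≤-trans (fracValue≤load Q covers F w≥0)
      (ℚ.≤-trans (sumℚ-mono load≤ Q) (ℚ.≤-reflexive (trans (sumℚ-toℚ cap Q)
        (cong toℚ (trans (tot-concatMap cap (cutEdges ∘ X) Ts) (tot-cong (tot-cutEdges ∘ X) Ts))))))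
      where
      Ts : List (Fin n)
      Ts = filter (_∈? T) (allFin n)

      Q : List (Fin m)
      Q = concatMap (cutEdges ∘ X) Ts

      covers : ∀ P → H (TPath.src P) (TPath.tgt P) ≡ true →
               ∃ λ e → e List.∈ TPath.edges P × e List.∈ Q
      covers P PH =
        let s , s∈T , a∈X , b∉X = separated PH
            e , e∈P , e∈cut = crossing N (X s) (TPath.edges P) (proj₁ (TPath.isPath P)) a∈X b∉X
        in e , e∈P , ∈-concatMap⁺ (cutEdges ∘ X)
             (List.lose (∈-filter⁺ (_∈? T) (∈-allFin s) s∈T) (∈-filter⁺ (crosses? (X s)) (∈-allFin e) e∈cut))

  -- Existence of minimum cuts

  minCut : {Adm : Subset n → Set} → (∀ X → Dec (Adm X)) → ∃ Adm → ∃ λ k → IsMinCut N Adm k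
  minCut {Adm} Adm? (X₀ , adm₀) = go (cut N X₀) X₀ adm₀ ≤-refl
    where
    -- `k` bounds the current cut and decreases with every improvement.
    go : ∀ k X → Adm X → cut N X ≤ k → ∃ (IsMinCut N Adm)
    go k X adm X≤k with anySubset? (λ Y → Adm? Y ×-dec (cut N Y ℕ.<? cut N X))
    ... | no none = cut N X , (X , adm , refl) , λ Y admY → ≮⇒≥ (λ lt → none (Y , admY , lt))
    go zero    X adm X≤k | yes (Y , admY , lt) = contradiction (≤-trans lt X≤k) n≮0
    go (suc k) X adm X≤k | yes (Y , admY , lt) = go k Y admY (≤-pred (≤-trans lt X≤k))

CutAdmissible? : ∀ {n} (S : Subset n) H ty s X → Dec (CutAdmissible S H ty s X)
CutAdmissible? S H sink-type s X =
  (s ∈? X) ×-dec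
  Fin.all? (λ t → ((H s t Bool.≟ true) ⊎-dec (H t s Bool.≟ true)) →-dec ¬? (t ∈? X))
CutAdmissible? S H source-type s X =
  Fin.all? (λ t → ((H s t Bool.≟ true) ⊎-dec (H t s Bool.≟ true)) →-dec (t ∈? X)) ×-dec
  ¬? (s ∈? X)

InN-irrefl : ∀ {n} (S : Subset n) H → SimpleOn S H → ∀ s → ¬ InN S H s s
InN-irrefl S H simple s (inj₁ ss) = true≢false ss (proj₁ simple s)
InN-irrefl S H simple s (inj₂ ss) = true≢false ss (proj₁ simple s)

∈-single : ∀ {n} (s : Fin n) → s ∈ single s
∈-single s = lookup⇒[]= s (single s) (trans (lookup-single s s) (dec-true (s ≟ s) refl))

∈-single⁻ : ∀ {n} {s t : Fin n} → t ∈ single s → t ≡ s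
∈-single⁻ {s = s} {t} t∈ = does⇒≡ (trans (sym (lookup-single s t)) ([]=⇒lookup t∈))

admissible : ∀ {n} (S : Subset n) H → SimpleOn S H → ∀ ty s → ∃ (CutAdmissible S H ty s)
admissible S H simple sink-type s =
  single s , ∈-single s , λ t st t∈ → InN-irrefl S H simple s (subst (InN S H s) (∈-single⁻ t∈) st)
admissible S H simple source-type s =
  ∁ (single s) ,
  (λ t st → x∉p⇒x∈∁p λ t∈ → InN-irrefl S H simple s (subst (InN S H s) (∈-single⁻ t∈) st)) ,
  x∈p⇒x∉∁p (∈-single s)

lookup⇒∉ : ∀ {n} {v} {X : Subset n} → lookup X v ≡ false → v ∉ X
lookup⇒∉ Xv v∈X = true≢false ([]=⇒lookup v∈X) Xv

adj⇒InN : ∀ {n} (S : Subset n) H {s t} → InN S H s t → adj H s t ≡ true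
adj⇒InN S H {s} {t} (inj₁ st) rewrite st = refl
adj⇒InN S H {s} {t} (inj₂ ts) rewrite ts = Bool.∨-zeroʳ (H s t)

-- Assembling the min-max equality

module _ {n m : ℕ} (N : Network n m) where
  open Network N

  cut-lv : ∀ X → cut N X ≡ Σℕ m (λ e → cap e * lv (lookup X (tail e)) (lookup X (head e)))
  cut-lv X = tot-cong arc (allFin m)
    where
    arc : ∀ e → (if does (tail e ∈? X) then (if does (head e ∈? X) then 0 else cap e) else 0)
              ≡ cap e * lv (lookup X (tail e)) (lookup X (head e))
    arc e rewrite does-∈? X (tail e) | does-∈? X (head e) with lookup X (tail e) | lookup X (head e)
    ... | true  | true  = sym (*-zeroʳ (cap e))
    ... | true  | false = sym (*-identityʳ (cap e))
    ... | false | _     = sym (*-zeroʳ (cap e))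

  -- Arcs leaving the complement are the arcs that leave `X` once all arcs are reversed.
  cut-∁ : ∀ X → cut N (∁ X) ≡ Σℕ m (λ e → cap e * lv (lookup X (head e)) (lookup X (tail e)))
  cut-∁ X = trans (cut-lv (∁ X)) (tot-cong arc (allFin m))
    where
    arc : ∀ e → cap e * lv (lookup (∁ X) (tail e)) (lookup (∁ X) (head e))
              ≡ cap e * lv (lookup X (head e)) (lookup X (tail e))
    arc e rewrite lookup-map (tail e) not X | lookup-map (head e) not X
                | Bool.not-involutive (lookup X (head e)) =
      cong (λ b → cap e * ind b) (Bool.∧-comm (not (lookup X (tail e))) _)

  degree-sum : ∀ (end : Fin m → Fin n) v →
               Σℕ m (λ e → cap e * ind (does (end e ≟ v))) ≡ Σℕ m (λ e → if does (end e ≟ v) then cap e else 0)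
  degree-sum end v = tot-cong (λ e → *-ind (cap e) _) (allFin m)

  module _ {H : Fin n → Fin n → Bool} (ty : QCType) (simple : SimpleOn S H) where

    minimum : ∀ s → ∃ λ k → IsMinCut N (CutAdmissible S H ty s) k
    minimum s = minCut N (CutAdmissible? S H ty s) (admissible S H simple ty s)

    κ : Fin n → ℕ
    κ s = proj₁ (minimum s)

    κ≤cut : ∀ s X → CutAdmissible S H ty s X → κ s ≤ cut N X
    κ≤cut s = proj₂ (proj₂ (minimum s))

    -- The part common to both types: `separated` gives the upper bound through minimising sets, and
    -- the packing gives a multiflow that attains it.
    duality : ∀ {T} →
      (∀ {a b} → H a b ≡ true →
        ∃ λ s → s ∈ T × (∀ X → CutAdmissible S H ty s X → a ∈ X × b ∉ X)) →
      (∃ λ M → (∀ e → tot (count N e) M ≤ cap e) ×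
               Σℕ-over T κ ≤ tot (λ x → ind (H (Walk.from x) (Walk.to x))) M) →
      ∃ λ (κ : Fin n → ℕ) →
        (∀ s → s ∈ T → IsMinCut N (CutAdmissible S H ty s) (κ s)) ×
        (∃ λ (F : IntMultiflow N) → IntFeasible N F × intValue N (μ S H) F ≡ Σℕ-over T κ) ×
        (∀ (F : FracMultiflow N) → FracFeasible N F → fracValue N (μ S H) F ≤ℚ toℚ (Σℕ-over T κ))
    duality {T} separated (M , cheap , value) =
      let F , val , F≤M = multiflow N simple M (Σℕ-over T κ) value
      in κ , (λ s _ → proj₂ (minimum s)) , (F , (λ e → ≤-trans (F≤M e) (cheap e)) , val) ,
         λ F feasible → subst (λ k → fracValue N (μ S H) F ≤ℚ toℚ k)
           (tot-cong (λ s → proj₂ (proj₂ (proj₁ (proj₂ (minimum s))))) (filter (_∈? T) (allFin n)))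
           (weakDuality N T X
             (λ ab → let s , s∈T , sep = separated ab in s , s∈T , sep (X s) (proj₁ (proj₂ (proj₁ (proj₂ (minimum s))))))
             F feasible)
      where
      X : Fin n → Subset n
      X s = proj₁ (proj₁ (proj₂ (minimum s)))

-- Reversal and the two types

QuasiComplete-flip : ∀ {n} {S : Subset n} {H T} →
                     QuasiComplete S H T source-type → QuasiComplete S (flip H) T sink-type
QuasiComplete-flip ((irrefl , inS) , T⊆S , incident , complete , source) =
  (irrefl , λ s t ts → swap (inS t s ts)) , T⊆S , (λ s t ts → ⊎-swap (incident t s ts)) ,
  (λ s t s∈T t∈T s≢t → complete t s t∈T s∈T (s≢t ∘ sym)) , λ s t ts s∉T t∈T → source t s ts t∈T s∉T

theorem3p8 : ∀ {n m : ℕ} (N : Network n m) (H : Fin n → Fin n → Bool)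
    (T : Subset n) (ty : QCType) →
    QuasiComplete (Network.S N) H T ty →
    InnerEulerian N →
    (∀ s → s ∈ Network.S N → deg (Network.S N) H s + 2 ≤ ∣ T ∣ → Eulerian N s) →
    ∃ λ (κ : Fin n → ℕ) →
    (∀ s → s ∈ T → IsMinCut N (CutAdmissible (Network.S N) H ty s) (κ s)) ×
    (∃ λ (F : IntMultiflow N) → IntFeasible N F ×
    intValue N (μ (Network.S N) H) F ≡ Σℕ-over T κ) ×
    (∀ (F : FracMultiflow N) → FracFeasible N F →
    fracValue N (μ (Network.S N) H) F ≤ℚ toℚ (Σℕ-over T κ))
theorem3p8 {n} {m} N H T ty qc inner eul = go ty qc
  where
  open Network N

  eulerian : ∀ v → deg S H v + 2 ≤ ∣ T ∣ → Eulerian N v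
  eulerian v small with v ∈? S
  ... | yes v∈S = eul v v∈S small
  ... | no v∉S  = inner v v∉S

  deg-flip : ∀ v → deg S (flip H) v ≡ deg S H v
  deg-flip v = tot-cong (λ u → +-comm (μ S H u v) (μ S H v u)) (allFin n)

  go : ∀ ty → QuasiComplete S H T ty →
       ∃ λ (κ : Fin n → ℕ) →
         (∀ s → s ∈ T → IsMinCut N (CutAdmissible S H ty s) (κ s)) ×
         (∃ λ (F : IntMultiflow N) → IntFeasible N F × intValue N (μ S H) F ≡ Σℕ-over T κ) ×
         (∀ (F : FracMultiflow N) → FracFeasible N F → fracValue N (μ S H) F ≤ℚ toℚ (Σℕ-over T κ))
  go sink-type qc = duality N sink-type (proj₁ qc)
    -- The sets of the tail separate an edge of `H`, and the tail lies in `T`.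
    (λ {a} ab → a , tail∈T qc ab , λ X (a∈X , far) → a∈X , far _ (inj₁ ab))
    (Packing.packing Walk.from Walk.to (count N) (concat N) (unit N) (count-unit N) cap
      {S} {H} {T} qc (κ N sink-type (proj₁ qc))
      (λ {s} s∈T Z (Zs , ZN) → ≤-trans
        (κ≤cut N sink-type (proj₁ qc) s Z (lookup⇒[]= s Z Zs , λ t st → lookup⇒∉ (ZN t (adj⇒InN S H st))))
        (≤-reflexive (cut-lv N Z)))
      (λ v small → trans (degree-sum N tail v) (trans (eulerian v small) (sym (degree-sum N head v)))))
  go source-type qc = duality N source-type (proj₁ qc)
    -- The tail of a reversed edge is its head, so here the sets of the head separate.
    (λ {b = b} ab → b , tail∈T qc′ ab , λ X (near , b∉X) → near _ (inj₂ ab) , b∉X)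
    (Packing.packing Walk.to Walk.from (count N)
      -- In forward direction the walk `y` comes first.
      (λ x y eq → let z , z-from , z-to , z-count = concat N y x (sym eq)
                  in z , z-to , z-from , λ e → trans (z-count e) (+-comm (count N e y) _))
      (unit N) (count-unit N) cap
      {S} {flip H} {T} qc′ (κ N source-type (proj₁ qc))
      -- The complement of `Z` is a set of the source-type formula, with the cut of `Z` along
      -- reversed arcs.
      (λ {s} s∈T Z (Zs , ZN) → ≤-trans
        (κ≤cut N source-type (proj₁ qc) s (∁ Z)
          ((λ t st → x∉p⇒x∈∁p (lookup⇒∉ (ZN t (adj⇒InN S (flip H) (⊎-swap st))))) ,
           x∈p⇒x∉∁p (lookup⇒[]= s Z Zs)))
        (≤-reflexive (cut-∁ N Z)))
      (λ v small → trans (degree-sum N head v)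
        (trans (sym (eulerian v (subst (λ d → d + 2 ≤ ∣ T ∣) (deg-flip v) small))) (sym (degree-sum N tail v)))))
    where qc′ = QuasiComplete-flip qc
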